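{- $\liminf_{k \to \infty} \#I(k) \leq 1$; that is, there are infinitely many positive integers $k$ with $\#I(k)\le 1$.
   Context: For a prime $p$ and $c\in\mathbb{Z}^+$, let $I_{p,c}=\{p^c, p^c+1,\dots,p^c+p^{c-1}-1\}$. For a positive integer $k$, $\#I(k)$ denotes the number of pairs $(p,c)$ with $p$ prime, $c\in\mathbb{Z}^+$, and $k\in I_{p,c}$. -}

module Defs where

open import Data.Nat using (ℕ; zero; suc; _+_; _∸_; _^_; _≤_; _<_; _≤?_; _<?_)
open import Data.Nat.Primality using (Prime; prime?)
open import Data.List using (List; length; filter; cartesianProduct; upTo)
open import Data.Product using (_×_; _,_)
open import Relation.Nullary.Decidable using (Dec; _×-dec_)

_∈I[_,_] : ℕ → ℕ → ℕ → Set
k ∈I[ p , c ] = p ^ c ≤ k × k < p ^ c + p ^ (c ∸ 1)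

IPair : ℕ → ℕ × ℕ → Set
IPair k (p , c) = Prime p × (1 ≤ c × k ∈I[ p , c ])

IPair? : (k : ℕ) → (pc : ℕ × ℕ) → Dec (IPair k pc)
IPair? k (p , c) = prime? p ×-dec ((1 ≤? c) ×-dec ((p ^ c ≤? k) ×-dec (k <? p ^ c + p ^ (c ∸ 1))))

-- #I(k): number of pairs (p , c) with p prime, c ≥ 1, k ∈ I_{p,c}.
-- Any such pair has p ≤ p^c ≤ k and c < 2^c ≤ p^c ≤ k, so enumerating
-- p , c ∈ {0, ..., k} counts all of them (each exactly once).
#I : ℕ → ℕ
#I k = length (filter (IPair? k) (cartesianProduct (upTo (suc k)) (upTo (suc k))))

{-# OPTIONS --safe #-}

-- Give each k < 2^L the weight 1/k.  Then I_{p,c} has weight at most 1/p, so the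
-- prime p contributes at most (1/p) (L / log₂ p) in total, and the sum of
-- 1 / (p log₂ p) over odd primes is about 0.63; explicit values below 128 and
-- Chebyshev's bound on the primes in (2^j, 2^(j+1)] beyond give at most 750/840.
-- If #I(k) ≥ 2 for all large k, then k lies in an interval of an odd prime at
-- least once, and twice when k is in [3·2^(i-1), 2^(i+1)), which no I_{2,c} meets.
-- So the odd primes must contribute at least 1/5 + 1/6 + 2/7 + 2/8 = 758/840 per
-- dyadic block, which is too much once L is large.  Everything is scaled to ℕ.

module Submission where

open import Defs
open import Data.Nat using (ℕ; _≤_; _<_)
open import Data.Product using (∃-syntax; _×_)

open import Data.Bool.Base using (if_then_else_; true; false)
open import Data.List using (List; []; _∷_; _++_; length; filter; map; cartesianProduct; upTo; applyUpTo)
open import Data.List.Properties using (map-upTo; map-applyUpTo; map-++; map-∘; map-cong)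
open import Data.List.Relation.Unary.All as All using (All; []; _∷_)
import Data.List.Relation.Unary.All.Properties as All
open import Data.List.Relation.Unary.AllPairs using ([]; _∷_)
open import Data.List.Relation.Unary.Unique.Propositional using (Unique)
import Data.List.Relation.Unary.Unique.Propositional.Properties as Unique
open import Data.Nat
  using (zero; suc; _+_; _*_; _∸_; _^_; _/_; _!; _≤?_; _<?_; _≟_; z≤n; s≤s; z<s; s<s; NonZero; >-nonZero; >-nonZero⁻¹; nonTrivial⇒n>1)
open import Data.Nat.Combinatorics
  using (_C_; nCk≡n!/k![n-k]!; k![n∸k]!∣n!; nCk+nC[k+1]≡[n+1]C[k+1])
open import Data.Nat.Divisibility using (_∣_; divides; ∣-trans; ∣⇒≤; m∣m*n; m≤n⇒m!∣n!; 1∣_)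
open import Data.Nat.DivMod using (m/n*n≤m; m*n/n≡m; /-monoˡ-≤; m/n*n≡m)
open import Data.Nat.ListAction using (sum; product)
open import Data.Nat.ListAction.Properties using (sum-++)
open import Data.Nat.Primality using (Prime; prime?; euclidsLemma; prime⇒nonZero; prime⇒nonTrivial; ¬prime[1])
open import Data.Nat.Primality.Factorisation using (factorisationHasAllPrimeFactors)
open import Data.Nat.Properties
open import Data.Nat.Tactic.RingSolver using (solve-∀)
open import Data.Product using (_,_; proj₁; proj₂)
open import Data.Sum using (inj₁; inj₂)
open import Function using (_∘_)
open import Relation.Binary.PropositionalEquality
open import Relation.Nullary using (¬_; Dec; yes; no; does; contradiction; _×-dec_)
open import Relation.Nullary.Decidable using (True; False; toWitness; toWitnessFalse; dec-true)
open import Relation.Unary using (Pred; Decidable)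

-- Finite sums and indicators

∑ : ℕ → (ℕ → ℕ) → ℕ
∑ n f = sum (applyUpTo f n)

𝟙 : ∀ {a} {A : Set a} → Dec A → ℕ
𝟙 d = if does d then 1 else 0

∑-mono-≤ : ∀ n {f g} → (∀ i → i < n → f i ≤ g i) → ∑ n f ≤ ∑ n g
∑-mono-≤ zero    f≤g = z≤n
∑-mono-≤ (suc n) f≤g = +-mono-≤ (f≤g 0 z<s) (∑-mono-≤ n λ i i<n → f≤g (suc i) (s<s i<n))

∑-cong : ∀ n {f g} → (∀ i → i < n → f i ≡ g i) → ∑ n f ≡ ∑ n g
∑-cong zero    f≡g = refl
∑-cong (suc n) f≡g = cong₂ _+_ (f≡g 0 z<s) (∑-cong n λ i i<n → f≡g (suc i) (s<s i<n))

∑-const : ∀ n c → ∑ n (λ _ → c) ≡ n * c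
∑-const zero    c = refl
∑-const (suc n) c = cong (c +_) (∑-const n c)

∑-zero : ∀ n {f} → (∀ i → i < n → f i ≡ 0) → ∑ n f ≡ 0
∑-zero n f≡0 = trans (∑-cong n f≡0) (trans (∑-const n 0) (*-zeroʳ n))

∑-split : ∀ m n f → ∑ (m + n) f ≡ ∑ m f + ∑ n (λ i → f (m + i))
∑-split zero    n f = refl
∑-split (suc m) n f = trans (cong (f 0 +_) (∑-split m n (f ∘ suc))) (sym (+-assoc (f 0) _ _))

∑-extend : ∀ {m n} f → m ≤ n → ∑ m f ≤ ∑ n f
∑-extend f z≤n       = z≤n
∑-extend f (s≤s m≤n) = +-monoʳ-≤ (f 0) (∑-extend (f ∘ suc) m≤n)

∑-+ : ∀ n f g → ∑ n (λ i → f i + g i) ≡ ∑ n f + ∑ n g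
∑-+ zero    f g = refl
∑-+ (suc n) f g = trans (cong (f 0 + g 0 +_) (∑-+ n (f ∘ suc) (g ∘ suc)))
  (interchange (f 0) (g 0) (∑ n (f ∘ suc)) (∑ n (g ∘ suc)))
  where
  interchange : ∀ a b c d → a + b + (c + d) ≡ a + c + (b + d)
  interchange = solve-∀

*-distribˡ-∑ : ∀ a n f → a * ∑ n f ≡ ∑ n (λ i → a * f i)
*-distribˡ-∑ a zero    f = *-zeroʳ a
*-distribˡ-∑ a (suc n) f = trans (*-distribˡ-+ a (f 0) _) (cong (a * f 0 +_) (*-distribˡ-∑ a n (f ∘ suc)))

*-distribʳ-∑ : ∀ a n f → ∑ n f * a ≡ ∑ n (λ i → f i * a)
*-distribʳ-∑ a zero    f = refl
*-distribʳ-∑ a (suc n) f = trans (*-distribʳ-+ a (f 0) _) (cong (f 0 * a +_) (*-distribʳ-∑ a n (f ∘ suc)))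

∑-comm : ∀ m n (f : ℕ → ℕ → ℕ) → ∑ m (λ i → ∑ n (f i)) ≡ ∑ n (λ j → ∑ m (λ i → f i j))
∑-comm zero    n f = sym (∑-zero n (λ _ _ → refl))
∑-comm (suc m) n f = trans (cong (∑ n (f 0) +_) (∑-comm m n (f ∘ suc)))
  (sym (∑-+ n (f 0) (λ j → ∑ m (λ i → f (suc i) j))))

∑-dyadic : ∀ J f → ∑ (2 ^ suc J) f ≡ ∑ (2 ^ J) f + ∑ (2 ^ J) (λ i → f (2 ^ J + i))
∑-dyadic J f rewrite +-identityʳ (2 ^ J) = ∑-split (2 ^ J) (2 ^ J) f

-- Serves to count the elements of an interval, the exponents of a prime, and the single prime 2.
-- The window `[q, q + r)` may stick out beyond `n`, so intervals cut off by the range are covered.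
∑-support : ∀ n q r {f B} → (∀ i → i < n → f i ≤ B) → (∀ i → i < q → f i ≡ 0) →
            (∀ i → i < n → q + r ≤ i → f i ≡ 0) → ∑ n f ≤ r * B
∑-support zero    q       r       f≤B below above = z≤n
∑-support (suc n) (suc q) r       {f} f≤B below above rewrite below 0 z<s =
  ∑-support n q r (λ i i<n → f≤B (suc i) (s<s i<n)) (λ i i<q → below (suc i) (s<s i<q))
    (λ i i<n q≤i → above (suc i) (s<s i<n) (s≤s q≤i))
∑-support (suc n) zero    zero    f≤B below above =
  ≤-reflexive (∑-zero (suc n) λ i i<n → above i i<n z≤n)
∑-support (suc n) zero    (suc r) f≤B below above =
  +-mono-≤ (f≤B 0 z<s) (∑-support n 0 r (λ i i<n → f≤B (suc i) (s<s i<n)) (λ _ ())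
    (λ i i<n r≤i → above (suc i) (s<s i<n) (s≤s r≤i)))

𝟙-yes : ∀ {a} {A : Set a} (d : Dec A) → A → 𝟙 d ≡ 1
𝟙-yes d x rewrite dec-true d x = refl

module _ {a} {A : Set a} where

  𝟙≤1 : (d : Dec A) → 𝟙 d ≤ 1
  𝟙≤1 (yes _) = ≤-refl
  𝟙≤1 (no  _) = z≤n

  𝟙-no : (d : Dec A) → ¬ A → 𝟙 d ≡ 0
  𝟙-no (yes x) ¬x = contradiction x ¬x
  𝟙-no (no  _) ¬x = refl

  𝟙*-≤ : (d : Dec A) → ∀ {m n} → (A → m ≤ n) → m * 𝟙 d ≤ n
  𝟙*-≤ (yes x) {m} m≤n = ≤-trans (≤-reflexive (*-identityʳ m)) (m≤n x)
  𝟙*-≤ (no  _) {m} m≤n = ≤-trans (≤-reflexive (*-zeroʳ m)) z≤n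

  𝟙-mono : ∀ {b} {B : Set b} (d : Dec A) (e : Dec B) → (A → B) → 𝟙 d ≤ 𝟙 e
  𝟙-mono (yes x) e f = ≤-reflexive (sym (𝟙-yes e (f x)))
  𝟙-mono (no _)  e f = z≤n

  length-filter≡sum : ∀ {p} {P : Pred A p} (P? : Decidable P) xs → length (filter P? xs) ≡ sum (map (𝟙 ∘ P?) xs)
  length-filter≡sum P? []       = refl
  length-filter≡sum P? (x ∷ xs) with does (P? x)
  ... | true  = cong suc (length-filter≡sum P? xs)
  ... | false = length-filter≡sum P? xs

  sum-cartesianProduct : ∀ {b} {B : Set b} (f : A × B → ℕ) xs ys →
    sum (map f (cartesianProduct xs ys)) ≡ sum (map (λ x → sum (map (λ y → f (x , y)) ys)) xs)
  sum-cartesianProduct f []       ys = refl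
  sum-cartesianProduct f (x ∷ xs) ys = begin
    sum (map f (map (x ,_) ys ++ cartesianProduct xs ys))
      ≡⟨ cong sum (map-++ f (map (x ,_) ys) _) ⟩
    sum (map f (map (x ,_) ys) ++ map f (cartesianProduct xs ys))
      ≡⟨ sum-++ (map f (map (x ,_) ys)) _ ⟩
    sum (map f (map (x ,_) ys)) + sum (map f (cartesianProduct xs ys))
      ≡⟨ cong₂ _+_ (cong sum (sym (map-∘ ys))) (sum-cartesianProduct f xs ys) ⟩
    sum (map (λ y → f (x , y)) ys) + _ ∎
    where open ≡-Reasoning

#I≡∑∑ : ∀ k → #I k ≡ ∑ (suc k) (λ p → ∑ (suc k) (λ c → 𝟙 (IPair? k (p , c))))
#I≡∑∑ k = begin
  #I k
    ≡⟨ length-filter≡sum (IPair? k) (cartesianProduct (upTo (suc k)) (upTo (suc k))) ⟩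
  sum (map (𝟙 ∘ IPair? k) (cartesianProduct (upTo (suc k)) (upTo (suc k))))
    ≡⟨ sum-cartesianProduct (𝟙 ∘ IPair? k) (upTo (suc k)) (upTo (suc k)) ⟩
  sum (map (λ p → sum (map (λ c → 𝟙 (IPair? k (p , c))) (upTo (suc k)))) (upTo (suc k)))
    ≡⟨ cong sum (map-cong (λ p → cong sum (map-upTo (λ c → 𝟙 (IPair? k (p , c))) (suc k))) (upTo (suc k))) ⟩
  sum (map (λ p → ∑ (suc k) (λ c → 𝟙 (IPair? k (p , c)))) (upTo (suc k)))
    ≡⟨ cong sum (map-upTo (λ p → ∑ (suc k) (λ c → 𝟙 (IPair? k (p , c)))) (suc k)) ⟩
  ∑ (suc k) (λ p → ∑ (suc k) (λ c → 𝟙 (IPair? k (p , c)))) ∎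
  where open ≡-Reasoning

-- A Chebyshev bound

nCk≤2^n : ∀ n k → n C k ≤ 2 ^ n
nCk≤2^n zero    zero    = ≤-refl
nCk≤2^n zero    (suc k) = z≤n
nCk≤2^n (suc n) zero    = >-nonZero⁻¹ (2 ^ suc n) {{m^n≢0 2 (suc n)}}
nCk≤2^n (suc n) (suc k) = begin
  suc n C suc k         ≡⟨ nCk+nC[k+1]≡[n+1]C[k+1] n k ⟨
  n C k + n C suc k     ≤⟨ +-mono-≤ (nCk≤2^n n k) (nCk≤2^n n (suc k)) ⟩
  2 ^ n + 2 ^ n         ≡⟨ cong (2 ^ n +_) (+-identityʳ (2 ^ n)) ⟨
  2 ^ suc n             ∎
  where open ≤-Reasoning

nCk*k![n∸k]!≡n! : ∀ {n k} → k ≤ n → (n C k) * (k ! * (n ∸ k) !) ≡ n !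
nCk*k![n∸k]!≡n! {n} {k} k≤n = trans (cong (_* (k ! * (n ∸ k) !)) (nCk≡n!/k![n-k]! k≤n))
  (m/n*n≡m {{k !* (n ∸ k) !≢0}} (k![n∸k]!∣n! k≤n))

prime∣n!⇒≤ : ∀ {p} → Prime p → ∀ n → p ∣ n ! → p ≤ n
prime∣n!⇒≤ pr zero    p∣1 = contradiction (subst Prime (n≤1⇒ _ (prime⇒nonZero pr) (∣⇒≤ p∣1)) pr) ¬prime[1]
  where
  n≤1⇒ : ∀ n → NonZero n → n ≤ 1 → n ≡ 1
  n≤1⇒ n nz n≤1 = ≤-antisym n≤1 (>-nonZero⁻¹ n {{nz}})
prime∣n!⇒≤ pr (suc n) p∣ with euclidsLemma (suc n) (n !) pr p∣
... | inj₁ p∣1+n = ∣⇒≤ p∣1+n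
... | inj₂ p∣n!  = m≤n⇒m≤1+n (prime∣n!⇒≤ pr n p∣n!)

n∣n! : ∀ n .{{_ : NonZero n}} → n ∣ n !
n∣n! (suc n) = m∣m*n (n !)

-- `p` divides `(2n)! = C(2n, n) n! n!`, but not `n!`, because `p > n`.
prime∣centralBinomial : ∀ {p n} → Prime p → n < p → p ≤ n + n → p ∣ (n + n) C n
prime∣centralBinomial {p} {n} pr n<p p≤2n
  with euclidsLemma ((n + n) C n) (n ! * (n + n ∸ n) !) pr
         (subst (p ∣_) (sym (nCk*k![n∸k]!≡n! (m≤m+n n n)))
           (∣-trans (n∣n! p {{prime⇒nonZero pr}}) (m≤n⇒m!∣n! p≤2n)))
... | inj₁ p∣C = p∣C
... | inj₂ p∣! with euclidsLemma (n !) ((n + n ∸ n) !) pr p∣!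
...   | inj₁ p∣n! = contradiction (prime∣n!⇒≤ pr n p∣n!) (<⇒≱ n<p)
...   | inj₂ p∣n! = contradiction (prime∣n!⇒≤ pr n (subst (λ m → p ∣ m !) (m+n∸n≡m n n) p∣n!)) (<⇒≱ n<p)

-- Write `n = q * product ps`. The next prime divides `q`: otherwise it would divide `product ps`
-- and hence occur in `ps`, against uniqueness.
product-primes-∣ : ∀ {ps n} → Unique ps → All Prime ps → All (_∣ n) ps → product ps ∣ n
product-primes-∣ []         []         []         = 1∣ _
product-primes-∣ {p ∷ ps} (p∉ps ∷ uniq) (pr ∷ prs) (p∣n ∷ ps∣n)
  with product-primes-∣ uniq prs ps∣n
... | divides q refl with euclidsLemma q (product ps) pr p∣n
...   | inj₁ (divides r refl) = divides r (*-assoc r p (product ps))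
...   | inj₂ p∣∏ = contradiction refl (All.lookup p∉ps (factorisationHasAllPrimeFactors pr p∣∏ prs))

^-length≤product : ∀ {b ns} → All (b ≤_) ns → b ^ length ns ≤ product ns
^-length≤product []         = ≤-refl
^-length≤product (b≤n ∷ bs) = *-mono-≤ b≤n (^-length≤product bs)

-- The primes in `(n, 2n]`, not those up to `n`.
primeCount : ℕ → ℕ
primeCount n = ∑ n (λ i → 𝟙 (prime? (suc n + i)))

-- Each prime counted exceeds `n`, and the product of them all divides the central binomial
-- coefficient, which is at most `2 ^ (n + n)`.
n^primeCount≤2^2n : ∀ n → n ^ primeCount n ≤ 2 ^ (n + n)
n^primeCount≤2^2n n = begin
  n ^ primeCount n      ≡⟨ cong (n ^_) primeCount≡length ⟩
  n ^ length ps         ≤⟨ ^-length≤product (All.filter⁺ prime? (All.applyUpTo⁺₁ _ n λ {i} _ → m≤n⇒m≤1+n (m≤m+n n i))) ⟩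
  product ps            ≤⟨ ∣⇒≤ {{>-nonZero 0<C}} ∏∣C ⟩
  (n + n) C n           ≤⟨ nCk≤2^n (n + n) n ⟩
  2 ^ (n + n)           ∎
  where
  open ≤-Reasoning
  candidates ps : List ℕ
  candidates = applyUpTo (suc n +_) n
  ps         = filter prime? candidates
  primeCount≡length : primeCount n ≡ length ps
  primeCount≡length = trans (cong sum (sym (map-applyUpTo (suc n +_) (𝟙 ∘ prime?) n)))
    (sym (length-filter≡sum prime? candidates))
  0<C : 0 < (n + n) C n
  0<C with (n + n) C n in eq
  ... | suc _ = z<s
  ... | zero  = contradiction
    (trans (sym (cong (_* (n ! * (n + n ∸ n) !)) eq)) (nCk*k![n∸k]!≡n! (m≤m+n n n)))
    (<⇒≢ (>-nonZero⁻¹ _ {{(n + n) !≢0}}))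
  in-range : All (λ p → n < p × p ≤ n + n) ps
  in-range = All.filter⁺ prime? (All.applyUpTo⁺₁ (suc n +_) n λ {i} i<n →
    s≤s (m≤m+n n i) , ≤-trans (≤-reflexive (sym (+-suc n i))) (+-monoʳ-≤ n i<n))
  ∏∣C : product ps ∣ (n + n) C n
  ∏∣C = product-primes-∣
    (Unique.filter⁺ prime? (Unique.applyUpTo⁺₁ (suc n +_) n
      λ i<j _ eq → <⇒≢ i<j (+-cancelˡ-≡ (suc n) _ _ eq)))
    (All.all-filter prime? candidates)
    (All.zipWith (λ { (pr , n<p , p≤2n) → prime∣centralBinomial pr n<p p≤2n })
      (All.all-filter prime? candidates , in-range))

2^-cancel-≤ : ∀ {m n} → 2 ^ m ≤ 2 ^ n → m ≤ n
2^-cancel-≤ 2^m≤2^n = ≮⇒≥ λ n<m → <⇒≱ (^-monoʳ-< 2 (s≤s (s≤s z≤n)) n<m) 2^m≤2^n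

-- At `n = 2 ^ j` both sides of the preceding bound are powers of 2, so its logarithm is an
-- inequality of integers.
chebyshev : ∀ j → j * primeCount (2 ^ j) ≤ 2 ^ suc j
chebyshev j = 2^-cancel-≤ (begin
  2 ^ (j * primeCount (2 ^ j))  ≡⟨ ^-*-assoc 2 j (primeCount (2 ^ j)) ⟨
  (2 ^ j) ^ primeCount (2 ^ j)  ≤⟨ n^primeCount≤2^2n (2 ^ j) ⟩
  2 ^ (2 ^ j + 2 ^ j)           ≡⟨ cong (λ x → 2 ^ (2 ^ j + x)) (+-identityʳ (2 ^ j)) ⟨
  2 ^ (2 ^ suc j)               ∎)
  where open ≤-Reasoning

-- Telescoping: 1/j² ≤ 1/(j-1) - 1/j.
∑-inverseSquares : ∀ A n J {x} → (∀ j → (suc J + j) * (suc J + j) * x j ≤ A) → J * ∑ n x ≤ A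
∑-inverseSquares A zero    J     x≤ = ≤-trans (≤-reflexive (*-zeroʳ J)) z≤n
∑-inverseSquares A (suc n) J {x} x≤ = *-cancelˡ-≤ (suc J * suc J) (begin
  suc J * suc J * (J * (x 0 + rest))
    ≡⟨ expand J (x 0) rest ⟩
  J * (suc J * suc J * x 0) + J * suc J * (suc J * rest)
    ≤⟨ +-mono-≤
         (*-monoʳ-≤ J (subst (λ s → s * s * x 0 ≤ A) (+-identityʳ (suc J)) (x≤ 0)))
         (*-monoʳ-≤ (J * suc J) (∑-inverseSquares A n (suc J) λ j →
           subst (λ s → s * s * x (suc j) ≤ A) (+-suc (suc J) j) (x≤ (suc j)))) ⟩
  J * A + J * suc J * A
    -- `J + J (J + 1)` is one short of `(J + 1)²`, so one more `A` completes the square.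
    ≤⟨ m≤m+n _ A ⟩
  J * A + J * suc J * A + A
    ≡⟨ collect J A ⟩
  suc J * suc J * A ∎)
  where
  open ≤-Reasoning
  rest : ℕ
  rest = ∑ n (x ∘ suc)
  expand : ∀ J x t → suc J * suc J * (J * (x + t)) ≡ J * (suc J * suc J * x) + J * suc J * (suc J * t)
  expand = solve-∀
  collect : ∀ J A → J * A + J * suc J * A + A ≡ suc J * suc J * A
  collect = solve-∀

-- Weighted incidences with the intervals of odd primes

oddPair? : ∀ k p c → Dec (2 < p × IPair k (p , c))
oddPair? k p c = (2 <? p) ×-dec IPair? k (p , c)

hit : ℕ → ℕ → ℕ → ℕ
hit k p c = 𝟙 (oddPair? k p c)

-- Weights are rounded down to integers; the scale e is chosen to make the lower
-- bounds for them exact.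
module Weighted (L e : ℕ) where

  -- `D` stands for the unit: `k` weighs `D / k`, rounded down. Since `e * Z = L * D`, a bound
  -- `u * Z` means `u / e` units per dyadic block below `2 ^ L`.
  D Z : ℕ
  D = e * 2 ^ L
  Z = L * 2 ^ L

  w : ℕ → ℕ
  w zero    = 0
  w (suc k) = D / suc k

  w[k]*k≤D : ∀ k → w k * k ≤ D
  w[k]*k≤D zero    = z≤n
  w[k]*k≤D (suc k) = m/n*n≤m D (suc k)

  -- The source of all lower bounds for weights: rounding down loses nothing against an integer `x`.
  ≤w : ∀ {x k K} → 0 < k → k ≤ K → x * K ≤ D → x ≤ w k
  ≤w {x} {suc k} _ k≤K x*K≤D = begin
    x                  ≡⟨ m*n/n≡m x (suc k) ⟨
    x * suc k / suc k  ≤⟨ /-monoˡ-≤ (suc k) (≤-trans (*-monoʳ-≤ x k≤K) x*K≤D) ⟩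
    D / suc k          ∎
    where open ≤-Reasoning

  -- The interval I_{p,c} has p^(c-1) elements, each of weight at most D/p^c.
  interval-weight : ∀ p c → p * ∑ (2 ^ L) (λ k → w k * hit k p c) ≤ D
  interval-weight p zero = ≤-trans (≤-reflexive (trans (cong (p *_) (∑-zero (2 ^ L) zero-hit)) (*-zeroʳ p))) z≤n
    where
    zero-hit : ∀ k → k < 2 ^ L → w k * hit k p 0 ≡ 0
    zero-hit k _ = trans (cong (w k *_) (𝟙-no (oddPair? k p 0) λ { (_ , _ , () , _) })) (*-zeroʳ (w k))
  interval-weight p (suc c) = begin
    p * ∑ (2 ^ L) (λ k → w k * hit k p (suc c))
      ≤⟨ *-monoʳ-≤ p (∑-support (2 ^ L) q r bound below above) ⟩
    -- `p * r` is `q` by definition of the power.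
    p * (r * w q)   ≡⟨ *-assoc p r (w q) ⟨
    q * w q         ≡⟨ *-comm q (w q) ⟩
    w q * q         ≤⟨ w[k]*k≤D q ⟩
    D               ∎
    where
    open ≤-Reasoning
    q r : ℕ
    q = p ^ suc c
    r = p ^ c
    zero-hit : ∀ k → ¬ (q ≤ k × k < q + r) → w k * hit k p (suc c) ≡ 0
    zero-hit k k∉I = trans (cong (w k *_) (𝟙-no (oddPair? k p (suc c)) λ { (_ , _ , _ , k∈I) → k∉I k∈I })) (*-zeroʳ (w k))
    below : ∀ k → k < q → w k * hit k p (suc c) ≡ 0
    below k k<q = zero-hit k λ { (q≤k , _) → <⇒≱ k<q q≤k }
    above : ∀ k → k < 2 ^ L → q + r ≤ k → w k * hit k p (suc c) ≡ 0
    above k _ q+r≤k = zero-hit k λ { (_ , k<q+r) → <⇒≱ k<q+r q+r≤k }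
    bound : ∀ k → k < 2 ^ L → w k * hit k p (suc c) ≤ w q
    bound k _ = 𝟙*-≤ (oddPair? k p (suc c)) {w k} λ { (_ , pr , _ , q≤k , _) →
      -- Weights do not increase with `k`: `w k * q ≤ w k * k ≤ D`.
      ≤w (>-nonZero⁻¹ q {{m^n≢0 p (suc c) {{prime⇒nonZero pr}}}}) ≤-refl (≤-trans (*-monoʳ-≤ (w k) q≤k) (w[k]*k≤D k)) }

  -- The range of `c` is crude; it has to contain the exponents up to `k` that `#I k` runs through,
  -- for every `k < 2 ^ L`.
  primeWeight : ℕ → ℕ
  primeWeight p = ∑ (2 ^ L) λ c → ∑ (2 ^ L) λ k → w k * hit k p c

  primeWeight-no : ∀ p → ¬ (2 < p × Prime p) → primeWeight p ≡ 0
  primeWeight-no p ¬p = ∑-zero (2 ^ L) λ c _ → ∑-zero (2 ^ L) λ k _ →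
    trans (cong (w k *_) (𝟙-no (oddPair? k p c) λ { (2<p , pr , _) → ¬p (2<p , pr) })) (*-zeroʳ (w k))

  -- 2^a ≤ p^b says 1 / log₂ p ≤ b / a, so p has at most L b / a powers below 2^L.
  primeWeight-bound : ∀ a b p .{{_ : NonZero a}} → 2 ^ a ≤ p ^ b → a * p * primeWeight p ≤ b * e * Z
  primeWeight-bound a b p 2^a≤p^b = begin
    a * p * primeWeight p
      ≡⟨ *-assoc a p (primeWeight p) ⟩
    a * (p * primeWeight p)
      ≡⟨ cong (a *_) (*-distribˡ-∑ p (2 ^ L) _) ⟩
    a * ∑ (2 ^ L) (λ c → p * ∑ (2 ^ L) (λ k → w k * hit k p c))
      -- Only the exponents from 1 to `b * L / a` count, each for at most `D`.
      ≤⟨ *-monoʳ-≤ a (∑-support (2 ^ L) 1 (b * L / a) (λ c _ → interval-weight p c) below above) ⟩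
    a * (b * L / a * D)
      ≡⟨ regroup a (b * L / a) D ⟩
    b * L / a * a * D
      ≤⟨ *-monoˡ-≤ D (m/n*n≤m (b * L) a) ⟩
    b * L * D
      ≡⟨ factor b L e (2 ^ L) ⟩
    b * e * Z ∎
    where
    open ≤-Reasoning
    regroup : ∀ a x d → a * (x * d) ≡ x * a * d
    regroup = solve-∀
    factor : ∀ b l e y → b * l * (e * y) ≡ b * e * (l * y)
    factor = solve-∀
    zero-hit : ∀ c → (∀ k → k < 2 ^ L → ¬ IPair k (p , c)) → p * ∑ (2 ^ L) (λ k → w k * hit k p c) ≡ 0
    zero-hit c ¬pair = trans (cong (p *_) (∑-zero (2 ^ L) λ k k<2^L →
      trans (cong (w k *_) (𝟙-no (oddPair? k p c) (¬pair k k<2^L ∘ proj₂))) (*-zeroʳ (w k)))) (*-zeroʳ p)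
    below : ∀ c → c < 1 → p * ∑ (2 ^ L) (λ k → w k * hit k p c) ≡ 0
    below zero    _  = zero-hit 0 λ { _ _ (_ , () , _) }
    below (suc c) (s≤s ())
    above : ∀ c → c < 2 ^ L → 1 + b * L / a ≤ c → p * ∑ (2 ^ L) (λ k → w k * hit k p c) ≡ 0
    above c _ 1+bL/a≤c = zero-hit c λ { k k<2^L (_ , _ , p^c≤k , _) → <⇒≱ 1+bL/a≤c (c≤bL/a (≤-trans p^c≤k (<⇒≤ k<2^L))) }
      where
      c≤bL/a : p ^ c ≤ 2 ^ L → c ≤ b * L / a
      c≤bL/a p^c≤2^L = begin
        c          ≡⟨ m*n/n≡m c a ⟨
        c * a / a  ≤⟨ /-monoˡ-≤ a (2^-cancel-≤ (begin
          2 ^ (c * a)  ≡⟨ cong (2 ^_) (*-comm c a) ⟩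
          2 ^ (a * c)  ≡⟨ ^-*-assoc 2 a c ⟨
          (2 ^ a) ^ c  ≤⟨ ^-monoˡ-≤ c 2^a≤p^b ⟩
          (p ^ b) ^ c  ≡⟨ ^-*-assoc p b c ⟩
          p ^ (b * c)  ≡⟨ cong (p ^_) (*-comm b c) ⟩
          p ^ (c * b)  ≡⟨ ^-*-assoc p c b ⟨
          (p ^ c) ^ b  ≤⟨ ^-monoˡ-≤ b p^c≤2^L ⟩
          (2 ^ L) ^ b  ≡⟨ ^-*-assoc 2 L b ⟩
          2 ^ (L * b)  ≡⟨ cong (2 ^_) (*-comm L b) ⟩
          2 ^ (b * L)  ∎)) ⟩
        b * L / a  ∎

  -- The range of `p` includes `2 ^ L`, so that above any smaller power of 2 it splits into blocks
  -- `(2^j, 2^(j+1)]`.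
  oddCount : ℕ → ℕ
  oddCount k = ∑ (suc (2 ^ L)) λ p → ∑ (2 ^ L) λ c → hit k p c

  -- The total weight of all incidences, sorted by `k` for the lower bound and by `p` for the upper
  -- bound.
  double-counting : ∑ (2 ^ L) (λ k → w k * oddCount k) ≡ ∑ (suc (2 ^ L)) primeWeight
  double-counting = begin
    ∑ M (λ k → w k * oddCount k)
      ≡⟨ ∑-cong M (λ k _ → trans (*-distribˡ-∑ (w k) (suc M) (λ p → ∑ M (hit k p)))
           (∑-cong (suc M) λ p _ → *-distribˡ-∑ (w k) M (hit k p))) ⟩
    ∑ M (λ k → ∑ (suc M) λ p → ∑ M λ c → w k * hit k p c)
      ≡⟨ ∑-comm M (suc M) (λ k p → ∑ M λ c → w k * hit k p c) ⟩
    ∑ (suc M) (λ p → ∑ M λ k → ∑ M λ c → w k * hit k p c)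
      ≡⟨ ∑-cong (suc M) (λ p _ → ∑-comm M M (λ k c → w k * hit k p c)) ⟩
    ∑ (suc M) primeWeight ∎
    where
    open ≡-Reasoning
    M : ℕ
    M = 2 ^ L

  -- Odd primes grouped into dyadic blocks

  blockWeight : ℕ → ℕ
  blockWeight j = ∑ (2 ^ j) (λ i → primeWeight (suc (2 ^ j) + i))

  -- A prime of the block `(2^j, 2^(j+1)]` has `p ≥ 2^j` and `log₂ p ≥ j`, hence weighs at most
  -- `e * Z / (j 2^j)`.
  blockWeight-bound : ∀ j .{{_ : NonZero j}} → j * 2 ^ j * blockWeight j ≤ primeCount (2 ^ j) * e * Z
  blockWeight-bound j = begin
    j * n * blockWeight j
      ≡⟨ *-distribˡ-∑ (j * n) n _ ⟩
    ∑ n (λ i → j * n * primeWeight (suc n + i))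
      ≤⟨ ∑-mono-≤ n (λ i _ → pointwise (suc n + i) (prime? (suc n + i)) (m≤n⇒m≤1+n (m≤m+n n i))) ⟩
    ∑ n (λ i → 𝟙 (prime? (suc n + i)) * (e * Z))
      ≡⟨ *-distribʳ-∑ (e * Z) n _ ⟨
    primeCount n * (e * Z)
      ≡⟨ *-assoc (primeCount n) e Z ⟨
    primeCount n * e * Z ∎
    where
    open ≤-Reasoning
    n : ℕ
    n = 2 ^ j
    pointwise : ∀ p (pr? : Dec (Prime p)) → n ≤ p → j * n * primeWeight p ≤ 𝟙 pr? * (e * Z)
    pointwise p (no ¬pr) n≤p = ≤-reflexive (trans (cong (j * n *_) (primeWeight-no p (¬pr ∘ proj₂))) (*-zeroʳ (j * n)))
    pointwise p (yes _)  n≤p = begin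
      j * n * primeWeight p  ≤⟨ *-monoˡ-≤ (primeWeight p) (*-monoʳ-≤ j n≤p) ⟩
      j * p * primeWeight p  ≤⟨ primeWeight-bound j 1 p (≤-trans n≤p (≤-reflexive (sym (*-identityʳ p)))) ⟩
      1 * e * Z              ≡⟨ *-assoc 1 e Z ⟩
      1 * (e * Z)            ∎

  -- By `chebyshev` the block has at most `2^(j+1) / j` primes, so `2^j` cancels and `2 / j²`
  -- remains.
  blockWeight-inverseSquare : ∀ j .{{_ : NonZero j}} → j * j * blockWeight j ≤ 2 * e * Z
  blockWeight-inverseSquare j = *-cancelˡ-≤ (2 ^ j) {{m^n≢0 2 j}} (begin
    2 ^ j * (j * j * blockWeight j)
      ≡⟨ regroup (2 ^ j) j (blockWeight j) ⟩
    j * (j * 2 ^ j * blockWeight j)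
      ≤⟨ *-monoʳ-≤ j (blockWeight-bound j) ⟩
    j * (primeCount (2 ^ j) * e * Z)
      ≡⟨ reassoc j (primeCount (2 ^ j)) e Z ⟩
    j * primeCount (2 ^ j) * (e * Z)
      ≤⟨ *-monoˡ-≤ (e * Z) (chebyshev j) ⟩
    2 * 2 ^ j * (e * Z)
      ≡⟨ factor (2 ^ j) e Z ⟩
    2 ^ j * (2 * e * Z) ∎)
    where
    open ≤-Reasoning
    regroup : ∀ y j x → y * (j * j * x) ≡ j * (j * y * x)
    regroup = solve-∀
    reassoc : ∀ j p e z → j * (p * e * z) ≡ j * p * (e * z)
    reassoc = solve-∀
    factor : ∀ y e z → 2 * y * (e * z) ≡ y * (2 * e * z)
    factor = solve-∀

  -- Summing `2 / j²` over `j > J` gives at most `2 / J`, a bound independent of `n`.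
  tail-bound : ∀ J n → J * ∑ n (λ j → blockWeight (suc J + j)) ≤ 2 * e * Z
  tail-bound J n = ∑-inverseSquares (2 * e * Z) n J λ j → blockWeight-inverseSquare (suc J + j)

  ∑-primeWeight-blocks : ∀ J n →
    ∑ (suc (2 ^ (J + n))) primeWeight ≡ ∑ (suc (2 ^ J)) primeWeight + ∑ n (λ j → blockWeight (J + j))
  ∑-primeWeight-blocks J zero    rewrite +-identityʳ J = sym (+-identityʳ _)
  ∑-primeWeight-blocks J (suc n) = begin
    ∑ (suc (2 ^ (J + suc n))) primeWeight
      ≡⟨ cong (λ i → ∑ (suc (2 ^ i)) primeWeight) (+-suc J n) ⟩
    ∑ (suc (2 ^ (suc J + n))) primeWeight
      ≡⟨ ∑-primeWeight-blocks (suc J) n ⟩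
    ∑ (suc (2 ^ suc J)) primeWeight + ∑ n (λ j → blockWeight (suc J + j))
      ≡⟨ cong₂ _+_ (trans (cong (primeWeight 0 +_) (∑-dyadic J (primeWeight ∘ suc))) (sym (+-assoc (primeWeight 0) _ _)))
           (∑-cong n λ j _ → cong blockWeight (sym (+-suc J j))) ⟩
    ∑ (suc (2 ^ J)) primeWeight + blockWeight J + ∑ n (λ j → blockWeight (J + suc j))
      ≡⟨ +-assoc (∑ (suc (2 ^ J)) primeWeight) (blockWeight J) _ ⟩
    ∑ (suc (2 ^ J)) primeWeight + (blockWeight J + ∑ n (λ j → blockWeight (J + suc j)))
      ≡⟨ cong (λ i → ∑ (suc (2 ^ J)) primeWeight + (blockWeight i + ∑ n (λ j → blockWeight (J + suc j)))) (+-identityʳ J) ⟨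
    ∑ (suc (2 ^ J)) primeWeight + ∑ (suc n) (λ j → blockWeight (J + j)) ∎
    where open ≡-Reasoning

  -- The prime 2, and lower bounds over dyadic blocks

  twoCount : ℕ → ℕ
  twoCount k = ∑ (2 ^ L) λ c → 𝟙 (IPair? k (2 , c))

  -- A prime other than 2 exceeds 2, so its pairs are counted by `oddCount`. The ranges in `#I k`
  -- are enlarged to ones that do not depend on `k`.
  #I≤twoCount+oddCount : ∀ k → k < 2 ^ L → #I k ≤ twoCount k + oddCount k
  #I≤twoCount+oddCount k k<M = begin
    #I k
      ≡⟨ #I≡∑∑ k ⟩
    ∑ (suc k) (λ p → ∑ (suc k) (pair p))
      ≤⟨ ∑-extend (λ p → ∑ (suc k) (pair p)) (m≤n⇒m≤1+n k<M) ⟩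
    ∑ (suc M) (λ p → ∑ (suc k) (pair p))
      ≤⟨ ∑-mono-≤ (suc M) (λ p _ → ∑-extend (pair p) k<M) ⟩
    ∑ (suc M) (λ p → ∑ M (pair p))
      ≤⟨ ∑-mono-≤ (suc M) (λ p _ → pointwise p) ⟩
    -- The count for 2 is written as a summand supported at `p = 2`, which `∑-support` then
    -- collapses.
    ∑ (suc M) (λ p → twoCount k * 𝟙 (p ≟ 2) + ∑ M (hit k p))
      ≡⟨ ∑-+ (suc M) (λ p → twoCount k * 𝟙 (p ≟ 2)) (λ p → ∑ M (hit k p)) ⟩
    ∑ (suc M) (λ p → twoCount k * 𝟙 (p ≟ 2)) + oddCount k
      ≤⟨ +-monoˡ-≤ (oddCount k) (∑-support (suc M) 2 1 (λ p _ → 𝟙*-≤ (p ≟ 2) {twoCount k} (λ _ → ≤-refl))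
           (λ p p<2 → zero-at p (<⇒≢ p<2)) (λ p _ 2<p → zero-at p (≢-sym (<⇒≢ 2<p)))) ⟩
    1 * twoCount k + oddCount k
      ≡⟨ cong (_+ oddCount k) (*-identityˡ (twoCount k)) ⟩
    twoCount k + oddCount k ∎
    where
    open ≤-Reasoning
    M : ℕ
    M = 2 ^ L
    pair : ℕ → ℕ → ℕ
    pair p c = 𝟙 (IPair? k (p , c))
    zero-at : ∀ p → p ≢ 2 → twoCount k * 𝟙 (p ≟ 2) ≡ 0
    zero-at p p≢2 = trans (cong (twoCount k *_) (𝟙-no (p ≟ 2) p≢2)) (*-zeroʳ (twoCount k))
    pointwise : ∀ p → ∑ M (pair p) ≤ twoCount k * 𝟙 (p ≟ 2) + ∑ M (hit k p)
    pointwise p with p ≟ 2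
    ... | yes refl = ≤-trans (≤-reflexive (sym (*-identityʳ (twoCount k)))) (m≤m+n _ _)
    ... | no p≢2   = ≤-trans (∑-mono-≤ M λ c _ → 𝟙-mono (IPair? k (p , c)) (oddPair? k p c) λ pair →
      ≤∧≢⇒< (nonTrivial⇒n>1 p {{prime⇒nonTrivial (proj₁ pair)}}) (≢-sym p≢2) , pair) (m≤n+m _ _)

  module _ {k i} (2^i≤k : 2 ^ suc i ≤ k) (k<2^i : k < 2 ^ suc (suc i)) where

    private
      below : ∀ c → c < suc i → 𝟙 (IPair? k (2 , c)) ≡ 0
      below zero    _     = 𝟙-no (IPair? k (2 , 0)) λ { (_ , () , _) }
      below (suc c) c<i   = 𝟙-no (IPair? k (2 , suc c)) λ { (_ , _ , _ , k<) → <⇒≱ k< (begin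
        2 ^ suc c + 2 ^ c        ≤⟨ +-monoʳ-≤ (2 ^ suc c) (^-monoʳ-≤ 2 (n≤1+n c)) ⟩
        2 ^ suc c + 2 ^ suc c    ≡⟨ cong (2 ^ suc c +_) (+-identityʳ (2 ^ suc c)) ⟨
        2 ^ suc (suc c)          ≤⟨ ^-monoʳ-≤ 2 c<i ⟩
        2 ^ suc i                ≤⟨ 2^i≤k ⟩
        k                        ∎) }
        where open ≤-Reasoning

      above : ∀ c → suc (suc i) ≤ c → 𝟙 (IPair? k (2 , c)) ≡ 0
      above c i<c = 𝟙-no (IPair? k (2 , c)) λ { (_ , _ , 2^c≤k , _) →
        <⇒≱ k<2^i (≤-trans (^-monoʳ-≤ 2 i<c) 2^c≤k) }

    -- For `c ≥ 1` the interval `I_{2,c}` lies in `[2^c, 2^(c+1))`, so `suc i` is the only exponent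
    -- possible for `k`.
    twoCount≤1 : twoCount k ≤ 1
    twoCount≤1 = ∑-support (2 ^ L) (suc i) 1 (λ c _ → 𝟙≤1 (IPair? k (2 , c))) below
      λ c _ 1+i+1≤c → above c (subst (_≤ c) (+-comm (suc i) 1) 1+i+1≤c)

    -- The interval for `suc i` ends just before `2 ^ suc i + 2 ^ i`, so no exponent is left and the
    -- window in `∑-support` is empty.
    twoCount≡0 : 2 ^ suc i + 2 ^ i ≤ k → twoCount k ≤ 0
    twoCount≡0 upper-half = ∑-support (2 ^ L) (suc i) 0 (λ c _ → 𝟙≤1 (IPair? k (2 , c))) below above′
      where
      above′ : ∀ c → c < 2 ^ L → suc i + 0 ≤ c → 𝟙 (IPair? k (2 , c)) ≡ 0
      above′ c _ i≤c with m≤n⇒m<n∨m≡n (subst (_≤ c) (+-identityʳ (suc i)) i≤c)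
      ... | inj₁ i<c  = above c i<c
      ... | inj₂ refl = 𝟙-no (IPair? k (2 , suc i)) λ { (_ , _ , _ , k<) → <⇒≱ k< upper-half }

  -- `o` runs through a quarter of a dyadic block. Each of its `2 ^ m` values weighs at least
  -- `D / (a 2^m)`, which is the integer `e′ * 2 ^ (L ∸ m)`, and is hit at least `d` times.
  part-bound : ∀ m (o : ℕ → ℕ) a e′ d → a * e′ ≡ e → m ≤ L →
    (∀ i → i < 2 ^ m → 0 < o i × o i ≤ a * 2 ^ m × d ≤ oddCount (o i)) →
    d * e′ * 2 ^ L ≤ ∑ (2 ^ m) (λ i → w (o i) * oddCount (o i))
  part-bound m o a e′ d a*e′≡e m≤L range = begin
    d * e′ * 2 ^ L            ≡⟨ cong (d * e′ *_) 2^L≡ ⟩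
    d * e′ * (2 ^ m * y)      ≡⟨ regroup d e′ (2 ^ m) y ⟩
    2 ^ m * (e′ * y * d)      ≡⟨ ∑-const (2 ^ m) (e′ * y * d) ⟨
    ∑ (2 ^ m) (λ _ → e′ * y * d)
      ≤⟨ ∑-mono-≤ (2 ^ m) (λ i i<n → let (0<o , o≤ , d≤) = range i i<n in
           *-mono-≤ (≤w {x = e′ * y} {K = a * 2 ^ m} 0<o o≤ (≤-reflexive weight)) d≤) ⟩
    ∑ (2 ^ m) (λ i → w (o i) * oddCount (o i)) ∎
    where
    open ≤-Reasoning
    y : ℕ
    y = 2 ^ (L ∸ m)
    2^L≡ : 2 ^ L ≡ 2 ^ m * y
    2^L≡ = trans (cong (2 ^_) (sym (m+[n∸m]≡n m≤L))) (^-distribˡ-+-* 2 m (L ∸ m))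
    regroup : ∀ d e n y → d * e * (n * y) ≡ n * (e * y * d)
    regroup = solve-∀
    rearrange : ∀ e y a n → e * y * (a * n) ≡ a * e * (n * y)
    rearrange = solve-∀
    weight : e′ * y * (a * 2 ^ m) ≡ D
    weight = trans (rearrange e′ y a (2 ^ m)) (cong₂ _*_ a*e′≡e (sym 2^L≡))

  -- The quarters of [4n, 8n) weigh at least D/5, D/6, D/7 and D/8.
  dyadicBlock-bound : ∀ m e₅ e₆ e₇ e₈ → 5 * e₅ ≡ e → 6 * e₆ ≡ e → 7 * e₇ ≡ e → 8 * e₈ ≡ e → suc (suc m) < L →
    (∀ k → 2 ^ suc (suc m) ≤ k → k < 2 ^ L → 2 ≤ #I k) →
    (e₅ + e₆ + (2 * e₇ + 2 * e₈)) * 2 ^ L ≤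
      ∑ (2 ^ suc (suc m)) (λ i → w (2 ^ suc (suc m) + i) * oddCount (2 ^ suc (suc m) + i))
  dyadicBlock-bound m e₅ e₆ e₇ e₈ eq₅ eq₆ eq₇ eq₈ m+2<L two-hits = begin
    (e₅ + e₆ + (2 * e₇ + 2 * e₈)) * 2 ^ L
      ≡⟨ distribute e₅ e₆ e₇ e₈ (2 ^ L) ⟩
    1 * e₅ * 2 ^ L + 1 * e₆ * 2 ^ L + (2 * e₇ * 2 ^ L + 2 * e₈ * 2 ^ L)
      ≤⟨ +-mono-≤
           (+-mono-≤
             (part-bound m (λ i → B + i) 5 e₅ 1 eq₅ m≤L λ i i<n →
               let b = end 0 5 (end₅ n) i<n in 0<B+ i , <⇒≤ b , lower i (within 5≤8 b))
             (part-bound m (λ i → B + (n + i)) 6 e₆ 1 eq₆ m≤L λ i i<n →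
               let b = end n 6 (end₆ n) i<n in 0<B+ (n + i) , <⇒≤ b , lower (n + i) (within 6≤8 b)))
           (+-mono-≤
             (part-bound m (λ i → B + (H + i)) 7 e₇ 2 eq₇ m≤L λ i i<n →
               let b = end H 7 (end₇ n) i<n in 0<B+ (H + i) , <⇒≤ b , upper i (within 7≤8 b))
             (part-bound m (λ i → B + (H + (n + i))) 8 e₈ 2 eq₈ m≤L λ i i<n →
               let b = subst (_< 8 * n) (cong (B +_) (+-assoc H n i)) (end (H + n) 8 (end₈ n) i<n)
               in 0<B+ (H + (n + i)) , <⇒≤ b , upper (n + i) (within ≤-refl b))) ⟩
    ∑ n g + ∑ n (λ i → g (n + i)) + (∑ n (λ i → g (H + i)) + ∑ n (λ i → g (H + (n + i))))
      ≡⟨ cong₂ _+_ (∑-dyadic m g) (∑-dyadic m (λ i → g (H + i))) ⟨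
    ∑ H g + ∑ H (λ i → g (H + i))
      ≡⟨ ∑-dyadic (suc m) g ⟨
    ∑ B g ∎
    where
    open ≤-Reasoning
    n H B : ℕ
    n = 2 ^ m
    H = 2 ^ suc m
    B = 2 ^ suc (suc m)
    g : ℕ → ℕ
    g i = w (B + i) * oddCount (B + i)
    m≤L : m ≤ L
    m≤L = ≤-trans (m≤n+m m 2) (<⇒≤ m+2<L)
    5≤8 : 5 ≤ 8
    5≤8 = m≤m+n 5 3
    6≤8 : 6 ≤ 8
    6≤8 = m≤m+n 6 2
    7≤8 : 7 ≤ 8
    7≤8 = m≤m+n 7 1
    distribute : ∀ a b c d y → (a + b + (2 * c + 2 * d)) * y ≡ 1 * a * y + 1 * b * y + (2 * c * y + 2 * d * y)
    distribute = solve-∀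
    end₅ : ∀ n → 2 * (2 * n) + (0 + n) ≡ 5 * n
    end₅ = solve-∀
    end₆ : ∀ n → 2 * (2 * n) + (n + n) ≡ 6 * n
    end₆ = solve-∀
    end₇ : ∀ n → 2 * (2 * n) + (2 * n + n) ≡ 7 * n
    end₇ = solve-∀
    end₈ : ∀ n → 2 * (2 * n) + (2 * n + n + n) ≡ 8 * n
    end₈ = solve-∀
    eight : ∀ n → 8 * n ≡ 2 * (2 * (2 * n))
    eight = solve-∀
    0<B+ : ∀ i → 0 < B + i
    0<B+ i = ≤-trans (m^n>0 2 (suc (suc m))) (m≤m+n B i)
    end : ∀ x a {i} → B + (x + n) ≡ a * n → i < n → B + (x + i) < a * n
    end x a eq i<n = <-≤-trans (+-monoʳ-< B (+-monoʳ-< x i<n)) (≤-reflexive eq)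
    within : ∀ {a k} → a ≤ 8 → k < a * n → k < 2 * B
    within a≤8 k<an = <-≤-trans k<an (≤-trans (*-monoˡ-≤ n a≤8) (≤-reflexive (eight n)))
    hits : ∀ i → B + i < 2 * B → 2 ≤ twoCount (B + i) + oddCount (B + i)
    hits i k<2B = ≤-trans (two-hits (B + i) (m≤m+n B i) k<M) (#I≤twoCount+oddCount (B + i) k<M)
      where
      k<M : B + i < 2 ^ L
      k<M = <-≤-trans k<2B (^-monoʳ-≤ 2 m+2<L)
    -- At most one of the two incidences is due to the prime 2, and in the upper half none is.
    lower : ∀ i → B + i < 2 * B → 1 ≤ oddCount (B + i)
    lower i k<2B = +-cancelˡ-≤ 1 _ _ (≤-trans (hits i k<2B) (+-monoˡ-≤ _ (twoCount≤1 {i = suc m} (m≤m+n B i) k<2B)))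
    upper : ∀ i → B + (H + i) < 2 * B → 2 ≤ oddCount (B + (H + i))
    upper i k<2B = ≤-trans (hits (H + i) k<2B) (+-monoˡ-≤ _
      (twoCount≡0 {i = suc m} (m≤m+n B (H + i)) k<2B (+-monoʳ-≤ B (m≤m+n H i))))

-- Numerical constants and the contradiction

*-scale-≤ : ∀ s t u x z .{{_ : NonZero s}} → s * x ≤ t * z → t ≤ s * u → x ≤ u * z
*-scale-≤ s t u x z sx≤tz t≤su = *-cancelˡ-≤ s (begin
  s * x        ≤⟨ sx≤tz ⟩
  t * z        ≤⟨ *-monoˡ-≤ z t≤su ⟩
  s * u * z    ≡⟨ *-assoc s u z ⟩
  s * (u * z)  ∎)
  where open ≤-Reasoning

-- 840 = lcm 5 6 7 8, as needed for dyadicBlock-bound.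
module _ (L : ℕ) where

  open Weighted L 840

  -- A record, because u cannot be inferred from u * Z.
  infix 4 _≼_
  record _≼_ (x u : ℕ) : Set where
    constructor bounded
    field bound : x ≤ u * Z

  open _≼_

  infixr 5 _⊕_
  _⊕_ : ∀ {x y u v} → x ≼ u → y ≼ v → x + y ≼ u + v
  _⊕_ {u = u} {v} (bounded x≤) (bounded y≤) = bounded (≤-trans (+-mono-≤ x≤ y≤) (≤-reflexive (sym (*-distribʳ-+ Z u v))))

  ∅ : 0 ≼ 0
  ∅ = bounded z≤n

  -- The side conditions, `log₂ p ≥ a / b` and `840 b / (a p) ≤ u`, are decided by evaluation.
  primeWeight≼ : ∀ a b p u .{{_ : NonZero (a * p)}} → .{{_ : NonZero a}} →
                 {_ : True (2 ^ a ≤? p ^ b)} {_ : True (b * 840 ≤? a * p * u)} → primeWeight p ≼ u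
  primeWeight≼ a b p u {2^a≤p^b} {b840≤apu} =
    bounded (*-scale-≤ (a * p) (b * 840) u (primeWeight p) Z (primeWeight-bound a b p (toWitness 2^a≤p^b)) (toWitness b840≤apu))

  primeWeight≼0 : ∀ p {_ : False ((2 <? p) ×-dec prime? p)} → primeWeight p ≼ 0
  primeWeight≼0 p {¬odd-prime} = bounded (≤-reflexive (primeWeight-no p (toWitnessFalse ¬odd-prime)))

  -- Here the primes of the block are counted by evaluation: for `j` from 4 to 6 the bound `2 / j²`
  -- coming from `chebyshev` would lift the final total above 758.
  blockWeight≼ : ∀ j u .{{_ : NonZero j}} .{{_ : NonZero (j * 2 ^ j)}} →
                 {_ : True (primeCount (2 ^ j) * 840 ≤? j * 2 ^ j * u)} → blockWeight j ≼ u
  blockWeight≼ j u {π840≤} =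
    bounded (*-scale-≤ (j * 2 ^ j) (primeCount (2 ^ j) * 840) u (blockWeight j) Z (blockWeight-bound j) (toWitness π840≤))

  -- The pairs (a , b) are rational approximations a/b of log₂ p from below; the
  -- last argument is ⌈840 b / (a p)⌉.
  primeWeight-below-17 : ∑ 17 primeWeight ≼ 338
  primeWeight-below-17 =
    primeWeight≼0 0 ⊕ primeWeight≼0 1 ⊕ primeWeight≼0 2 ⊕ primeWeight≼ 11 7 3 179 ⊕
    primeWeight≼0 4 ⊕ primeWeight≼ 9 4 5 75 ⊕ primeWeight≼0 6 ⊕ primeWeight≼ 14 5 7 43 ⊕
    primeWeight≼0 8 ⊕ primeWeight≼0 9 ⊕ primeWeight≼0 10 ⊕ primeWeight≼ 10 3 11 23 ⊕
    primeWeight≼0 12 ⊕ primeWeight≼ 11 3 13 18 ⊕ primeWeight≼0 14 ⊕ primeWeight≼0 15 ⊕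
    primeWeight≼0 16 ⊕ ∅

  -- The blocks ending at 32, 64 and 128 contain 5, 7 and 13 primes; each constant is
  -- `840 * primeCount (2 ^ j) / (j 2^j)`, rounded up.
  blockWeights-4-6 : ∑ 3 (λ j → blockWeight (4 + j)) ≼ 132
  blockWeights-4-6 = blockWeight≼ 4 66 ⊕ blockWeight≼ 5 37 ⊕ blockWeight≼ 6 29 ⊕ ∅

  -- 750 is 338 for the primes up to 16, plus 132 for those from there to 128, plus 280 beyond,
  -- where `tail-bound` at `J = 6` gives `2 * 840 / 6`.
  primeWeight-total : 7 ≤ L → ∑ (suc (2 ^ L)) primeWeight ≼ 750
  primeWeight-total 7≤L = subst (_≼ 750) (sym split)
    ((primeWeight-below-17 ⊕ blockWeights-4-6) ⊕
      bounded (*-scale-≤ 6 (2 * 840) 280 tail Z (tail-bound 6 (L ∸ 7)) ≤-refl))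
    where
    open ≡-Reasoning
    tail : ℕ
    tail = ∑ (L ∸ 7) (λ j → blockWeight (7 + j))
    split : ∑ (suc (2 ^ L)) primeWeight ≡ ∑ 17 primeWeight + ∑ 3 (λ j → blockWeight (4 + j)) + tail
    split = begin
      ∑ (suc (2 ^ L)) primeWeight
        ≡⟨ cong (λ i → ∑ (suc (2 ^ i)) primeWeight) (m+[n∸m]≡n 7≤L) ⟨
      ∑ (suc (2 ^ (7 + (L ∸ 7)))) primeWeight
        ≡⟨ ∑-primeWeight-blocks 7 (L ∸ 7) ⟩
      ∑ (suc (2 ^ 7)) primeWeight + tail
        ≡⟨ cong (_+ tail) (∑-primeWeight-blocks 4 3) ⟩
      ∑ 17 primeWeight + ∑ 3 (λ j → blockWeight (4 + j)) + tail ∎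

  -- Blocks are stacked on top of `2 ^ suc (suc i)`; the integers below it, about which nothing is
  -- assumed, are counted as 0.
  dyadic-total : ∀ i n → suc (suc i) + n ≤ L → (∀ k → 2 ^ suc (suc i) ≤ k → k < 2 ^ L → 2 ≤ #I k) →
                 n * (758 * 2 ^ L) ≤ ∑ (2 ^ (suc (suc i) + n)) (λ k → w k * oddCount k)
  dyadic-total i zero    i+2≤L   two-hits = z≤n
  dyadic-total i (suc n) i+n+3≤L two-hits = begin
    758 * 2 ^ L + n * (758 * 2 ^ L)
      ≤⟨ +-mono-≤
           -- 840 divided by 5, 6, 7 and 8; `168 + 140 + 2 * 120 + 2 * 105 = 758`.
           (dyadicBlock-bound (i + n) 168 140 120 105 refl refl refl refl i+n+2<L
             λ k 2^≤k → two-hits k (≤-trans (^-monoʳ-≤ 2 (s≤s (s≤s (m≤m+n i n)))) 2^≤k))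
           (dyadic-total i n (<⇒≤ i+n+2<L) two-hits) ⟩
    ∑ B (λ j → w (B + j) * oddCount (B + j)) + ∑ B (λ k → w k * oddCount k)
      ≡⟨ +-comm _ (∑ B (λ k → w k * oddCount k)) ⟩
    ∑ B (λ k → w k * oddCount k) + ∑ B (λ j → w (B + j) * oddCount (B + j))
      ≡⟨ ∑-dyadic (suc (suc i) + n) (λ k → w k * oddCount k) ⟨
    ∑ (2 ^ suc (suc (suc i) + n)) (λ k → w k * oddCount k)
      ≡⟨ cong (λ j → ∑ (2 ^ j) (λ k → w k * oddCount k)) (+-suc (suc (suc i)) n) ⟨
    ∑ (2 ^ (suc (suc i) + suc n)) (λ k → w k * oddCount k) ∎
    where
    open ≤-Reasoning
    B : ℕ
    B = 2 ^ (suc (suc i) + n)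
    i+n+2<L : suc (suc i) + n < L
    i+n+2<L = ≤-trans (≤-reflexive (sym (+-suc (suc (suc i)) n))) i+n+3≤L

  -- Of the `100 s` dyadic blocks below `2 ^ L`, where `s = i + 2`, the assumption covers `99 s`.
  -- Losing one percent is affordable, as `99 * 758 = 75042` still exceeds `100 * 750 = 75000`.
  not-all-two : ∀ i → L ≡ 100 * suc (suc i) → ¬ (∀ k → 2 ^ suc (suc i) ≤ k → k < 2 ^ L → 2 ≤ #I k)
  not-all-two i L≡ two-hits = <⇒≱ 75000<75042 (*-cancelʳ-≤ 75042 75000 s (*-cancelʳ-≤ _ _ (2 ^ L) {{m^n≢0 2 L}} (begin
    75042 * s * 2 ^ L
      ≡⟨ lower-constant s (2 ^ L) ⟩
    99 * s * (758 * 2 ^ L)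
      ≤⟨ dyadic-total i (99 * s) (≤-reflexive (sym L≡s+99s)) two-hits ⟩
    ∑ (2 ^ (s + 99 * s)) (λ k → w k * oddCount k)
      ≡⟨ cong (λ j → ∑ (2 ^ j) (λ k → w k * oddCount k)) L≡s+99s ⟨
    ∑ (2 ^ L) (λ k → w k * oddCount k)
      ≡⟨ double-counting ⟩
    ∑ (suc (2 ^ L)) primeWeight
      ≤⟨ bound (primeWeight-total 7≤L) ⟩
    750 * (L * 2 ^ L)
      ≡⟨ cong (λ l → 750 * (l * 2 ^ L)) L≡ ⟩
    750 * (100 * s * 2 ^ L)
      ≡⟨ upper-constant s (2 ^ L) ⟩
    75000 * s * 2 ^ L ∎)))
    where
    open ≤-Reasoning
    s : ℕ
    s = suc (suc i)
    75000<75042 : 75000 < 75042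
    75000<75042 = toWitness {a? = 75000 <? 75042} _
    lower-constant : ∀ s y → 75042 * s * y ≡ 99 * s * (758 * y)
    lower-constant s y = trans
      (cong (_* y) (trans (*-assoc 99 758 s) (trans (cong (99 *_) (*-comm 758 s)) (sym (*-assoc 99 s 758)))))
      (*-assoc (99 * s) 758 y)
    upper-constant : ∀ s y → 750 * (100 * s * y) ≡ 75000 * s * y
    upper-constant s y = trans (sym (*-assoc 750 (100 * s) y)) (cong (_* y) (sym (*-assoc 750 100 s)))
    L≡s+99s : L ≡ s + 99 * s
    L≡s+99s = L≡
    7≤L : 7 ≤ L
    7≤L = ≤-trans (toWitness {a? = 7 ≤? 100 * 2} _) (≤-trans (*-monoʳ-≤ 100 (s≤s (s≤s z≤n))) (≤-reflexive (sym L≡)))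

mainTheorem3 : (N : ℕ) → ∃[ k ] (N < k × #I k ≤ 1)
-- The search is bounded, hence decidable. Its failure gives at least two pairs for every `k` from
-- `2 ^ (N + 2)` up to the bound, because such `k` exceed `N`.
mainTheorem3 N with anyUpTo? (λ k → (N <? k) ×-dec (#I k ≤? 1)) (2 ^ (100 * suc (suc N)))
... | yes (k , _ , found) = k , found
... | no none = contradiction
  (λ k 2^N+2≤k k<M → ≰⇒> λ #I≤1 → none (k , k<M , <-≤-trans (n<2^2+n N) 2^N+2≤k , #I≤1))
  (not-all-two (100 * suc (suc N)) N refl)
  where
  n<2^2+n : ∀ n → n < 2 ^ (2 + n)
  n<2^2+n zero    = z<s
  n<2^2+n (suc n) = +-mono-≤ (m^n>0 2 (2 + n)) (≤-trans (n<2^2+n n) (m≤m+n _ 0))
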